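{- Recognizing relating edges and recognizing generating subgraphs in chordal graphs can be done in polynomial time. That is: (1) there is a polynomial-time algorithm which, given a chordal graph $G$ and an edge $xy \in E(G)$, decides whether $xy$ is a relating edge of $G$; and (2) there is a polynomial-time algorithm which, given a chordal graph $G$ and an induced complete bipartite subgraph $B$ of $G$, decides whether $B$ is a generating subgraph of $G$.
   Context: All graphs are finite, simple and undirected. A graph is chordal if every induced cycle is a triangle. A set of vertices is independent if its elements are pairwise nonadjacent; an independent set is maximal if it is not a proper subset of another independent set. Let $B$ be an induced complete bipartite subgraph of $G$ with (non-empty) bipartition sets $B_X$ and $B_Y$. $B$ is a generating subgraph of $G$ if there exists an independent set $S$ of $G$ such that each of $S \cup B_X$ and $S \cup B_Y$ is a maximal independent set of $G$. An edge $xy$ is relating if the subgraph $B$ with $B_X=\{x\}$, $B_Y=\{y\}$ (isomorphic to $K_{1,1}$) is generating. -}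

module Defs where

open import Level using (0ℓ)
open import Data.Bool.Base using (Bool; true; false)
open import Data.Fin.Base using (Fin; toℕ)
open import Data.Fin.Subset using (Subset; _∈_; _∪_; _⊂_; ⁅_⁆; Nonempty)
open import Data.Fin.Subset.Properties using (x∈⁅x⁆; x∈⁅y⁆⇒x≡y)
open import Data.List.Base as List using (List; []; _∷_; _++_; length)
open import Data.Maybe.Base using (Maybe; just; nothing)
open import Data.Nat.Base using (ℕ; zero; suc; _+_; _*_; _≤_)
open import Data.Product.Base using (∃; ∃-syntax; _×_; _,_)
open import Data.Sum.Base using (_⊎_)
open import Data.Vec.Base as Vec using (Vec; _∷_)
open import Function.Bundles using (_⇔_)
open import Function.Definitions using (Injective)
open import Relation.Binary.Core using (Rel)
open import Relation.Binary.Definitions using (Decidable; Irreflexive; Symmetric)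
open import Relation.Binary.PropositionalEquality.Core using (_≡_; refl; sym; subst₂; trans)
open import Relation.Nullary using (¬_; does; Reflects)

record Graph (n : ℕ) : Set₁ where
  infix 4 _~_ _~?_
  field
    _~_      : Rel (Fin n) 0ℓ
    ~-sym    : Symmetric _~_
    ~-irrefl : Irreflexive _≡_ _~_
    _~?_     : Decidable _~_

module _ {n : ℕ} (G : Graph n) where
  open Graph G

  -- i and j are neighbours on the cycle 0, 1, …, k - 1, 0.
  CyclicallyAdjacent : ∀ {k} → Rel (Fin k) 0ℓ
  CyclicallyAdjacent i j = Next i j ⊎ Next j i
    where
    Next : ∀ {k} → Rel (Fin k) 0ℓ
    Next {k} i j = suc (toℕ i) ≡ toℕ j ⊎ (suc (toℕ i) ≡ k × toℕ j ≡ 0)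

  record InducedCycle (k : ℕ) : Set where
    field
      3≤k       : 3 ≤ k
      vertex    : Fin k → Fin n
      injective : Injective _≡_ _≡_ vertex
      induced   : ∀ i j → vertex i ~ vertex j ⇔ CyclicallyAdjacent i j

  Chordal : Set
  Chordal = ∀ {k} → InducedCycle k → k ≡ 3

  Independent : Subset n → Set
  Independent S = ∀ {u v} → u ∈ S → v ∈ S → ¬ u ~ v

  MaximalIndependent : Subset n → Set
  MaximalIndependent S = Independent S × (∀ T → Independent T → ¬ S ⊂ T)

  -- The two sides are automatically disjoint, by `complete` and irreflexivity.
  record InducedCompleteBipartite : Set where
    field
      X Y           : Subset n
      X-nonempty    : Nonempty X
      Y-nonempty    : Nonempty Y
      X-independent : Independent X
      Y-independent : Independent Y
      complete      : ∀ {u v} → u ∈ X → v ∈ Y → u ~ v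

  Generating : InducedCompleteBipartite → Set
  Generating B = ∃[ S ] Independent S
                      × MaximalIndependent (S ∪ X)
                      × MaximalIndependent (S ∪ Y)
    where open InducedCompleteBipartite B

  ⁅⁆-independent : ∀ x → Independent ⁅ x ⁆
  ⁅⁆-independent x u∈ v∈ =
    ~-irrefl (trans (x∈⁅y⁆⇒x≡y x u∈) (sym (x∈⁅y⁆⇒x≡y x v∈)))

  edge : ∀ {x y} → x ~ y → InducedCompleteBipartite
  edge {x} {y} x~y = record
    { X             = ⁅ x ⁆
    ; Y             = ⁅ y ⁆
    ; X-nonempty    = x , x∈⁅x⁆ x
    ; Y-nonempty    = y , x∈⁅x⁆ y
    ; X-independent = ⁅⁆-independent x
    ; Y-independent = ⁅⁆-independent y
    ; complete      = λ u∈ v∈ →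
        subst₂ _~_ (sym (x∈⁅y⁆⇒x≡y x u∈)) (sym (x∈⁅y⁆⇒x≡y y v∈)) x~y
    }

  Relating : ∀ {x y} → x ~ y → Set
  Relating x~y = Generating (edge x~y)

data Move : Set where
  left stay right : Move

-- Tape symbols: the blank, the input bits, and g further symbols.
data Symbol (g : ℕ) : Set where
  blank : Symbol g
  bit   : Bool → Symbol g
  mark  : Fin g → Symbol g

data Action (g tapes states : ℕ) : Set where
  halt     : (answer : Bool) → Action g tapes states
  continue : Fin states → Vec (Symbol g × Move) tapes → Action g tapes states

-- All parameters are constants of the machine, independent of its input;
-- tape 0 carries the input and there are `extra` work tapes.
record TuringMachine : Set where
  field
    g extra states : ℕ
    start          : Fin states
    δ              : Fin states → Vec (Symbol g) (suc extra) → Action g (suc extra) states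

-- A two-way infinite tape.  Both lists run outwards from the head, and every
-- cell beyond their ends is blank.
record Tape (g : ℕ) : Set where
  constructor tape
  field
    before : List (Symbol g)
    head   : Symbol g
    after  : List (Symbol g)

uncons : ∀ {g} → List (Symbol g) → Symbol g × List (Symbol g)
uncons []       = blank , []
uncons (s ∷ ss) = s , ss

move : ∀ {g} → Move → Tape g → Tape g
move stay t = t
move left (tape ls h rs) with uncons ls
... | l , ls′ = tape ls′ l (h ∷ rs)
move right (tape ls h rs) with uncons rs
... | r , rs′ = tape (h ∷ ls) r rs′

writeMove : ∀ {g} → Tape g → Symbol g × Move → Tape g
writeMove (tape ls _ rs) (s , m) = move m (tape ls s rs)

-- The head is on the first symbol of the word.
loaded : ∀ {g} → List Bool → Tape g
loaded w with uncons (List.map bit w)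
... | s , ss = tape [] s ss

module _ (M : TuringMachine) where
  open TuringMachine M

  record Configuration : Set where
    constructor config
    field
      state : Fin states
      tapes : Vec (Tape g) (suc extra)

  initial : List Bool → Configuration
  initial w = config start (loaded w ∷ Vec.replicate extra (loaded []))

  -- The answer, if the machine halts within the given number of steps.
  run : ℕ → Configuration → Maybe Bool
  run zero    _             = nothing
  run (suc t) (config q ts) with δ q (Vec.map Tape.head ts)
  ... | halt b         = just b
  ... | continue q′ as = run t (config q′ (Vec.zipWith writeMove ts as))

-- A polynomial with natural-number coefficients, constant term first.
Polynomial : Set
Polynomial = List ℕ

evaluate : Polynomial → ℕ → ℕ
evaluate []       n = 0
evaluate (a ∷ as) n = a + n * evaluate as n

-- The machine sees only `encode I`.  Any promise on the input is part of
-- `Instance`: nothing is required on words that encode no instance.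
record DecisionProblem : Set₂ where
  field
    Instance : Set₁
    encode   : Instance → List Bool
    Yes      : Instance → Set

PolynomialTimeDecidable : DecisionProblem → Set₁
PolynomialTimeDecidable P =
  ∃[ M ] ∃[ p ] ∀ I → ∃[ b ]
    run M (evaluate p (length (encode I))) (initial M (encode I)) ≡ just b
    × Reflects (Yes I) b
  where open DecisionProblem P

adjacencyMatrix : ∀ {n} → Graph n → List Bool
adjacencyMatrix G =
  List.concat (List.tabulate λ u → List.tabulate λ v → does (u ~? v))
  where open Graph G

-- The number of vertices in unary, closed by a zero; the characteristic
-- vectors of the two vertex sets; the adjacency matrix, row by row.
encodeWith : ∀ {n} → Graph n → Subset n → Subset n → List Bool
encodeWith {n} G X Y =
  List.replicate n true ++ false ∷ Vec.toList X ++ Vec.toList Y ++ adjacencyMatrix G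

record ChordalGraphWithEdge : Set₁ where
  field
    {n}     : ℕ
    G       : Graph n
    chordal : Chordal G
    x y     : Fin n
    x~y     : Graph._~_ G x y

record ChordalGraphWithBipartite : Set₁ where
  field
    {n}     : ℕ
    G       : Graph n
    chordal : Chordal G
    B       : InducedCompleteBipartite G

-- An endpoint x is encoded as the characteristic vector of ⁅ x ⁆.
relatingEdge : DecisionProblem
relatingEdge = record
  { Instance = ChordalGraphWithEdge
  ; encode   = λ I → let open ChordalGraphWithEdge I in encodeWith G ⁅ x ⁆ ⁅ y ⁆
  ; Yes      = λ I → let open ChordalGraphWithEdge I in Relating G x~y
  }

generatingSubgraph : DecisionProblem
generatingSubgraph = record
  { Instance = ChordalGraphWithBipartite
  ; encode   = λ I → let open ChordalGraphWithBipartite I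
                         open InducedCompleteBipartite B
                     in encodeWith G X Y
  ; Yes      = λ I → let open ChordalGraphWithBipartite I in Generating G B
  }

{-# OPTIONS --safe #-}

-- Call a vertex outside X ∪ Y free if it has no neighbour in X ∪ Y, and
-- contested if it has neighbours in exactly one of X and Y.  If S witnesses
-- that B is generating, then S consists of free vertices, and maximality forces
-- every contested vertex to have a neighbour in S, hence a free neighbour.  In a
-- chordal graph the converse holds.  Serve the contested vertices one by one: if
-- t has no neighbour in the current independent set S of free vertices, replace
-- the neighbours in S of some free w ~ t by w.  A contested t′ that loses its
-- neighbour s by this is adjacent to w, as otherwise the path t w s t′ closes up
-- to an induced cycle of length at least four, through X ∪ Y if t ≁ t′.
--
-- The resulting local criterion is checked in linear time by a machine with three
-- tapes: the input, one class per column, and one class per row.  The rows of X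
-- and of Y mark the columns they hit; after that, the rows of free vertices
-- clear the contested columns they hit; the answer is yes if no contested
-- column remains.

module Submission where

open import Defs
open import Algebra.Bundles using (CommutativeMonoid)
open import Data.Bool.Base using (Bool; true; false; if_then_else_; _∨_; _∧_; not)
open import Data.Bool.Properties using
  (∧-zeroʳ; ∧-identityʳ; ∧-assoc; ∨-identityʳ; ∨-commutativeMonoid; ∨-∧-booleanAlgebra)
open import Algebra.Lattice.Properties.BooleanAlgebra ∨-∧-booleanAlgebra using (deMorgan₂)
open import Algebra.Properties.CommutativeSemigroup
  (CommutativeMonoid.commutativeSemigroup ∨-commutativeMonoid) using (x∙yz≈yx∙z)
open import Data.Empty using (⊥)
open import Data.Fin.Base using (Fin; zero; suc; toℕ; _<_; combine; remQuot)
open import Data.Fin.Patterns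
open import Data.Fin.Properties using (any?; <-cmp; _≟_; remQuot-combine)
open import Data.Fin.Subset using (Subset; _∈_; _∉_; _∪_; _⊂_; ⁅_⁆; Nonempty)
open import Data.Fin.Subset.Properties using
  (_∈?_; x∈p∪q⁺; x∈p∪q⁻; x∈⁅x⁆; x∈⁅y⁆⇒x≡y; p⊆p∪q; q⊆p∪q)
open import Data.List.Base using
  (List; []; _∷_; _++_; _ʳ++_; map; tabulate; concat; replicate; length; filter; allFin)
import Data.List.Membership.DecPropositional as DecMembership
open import Data.List.Membership.Propositional using (find; lose) renaming (_∈_ to _∈ₗ_)
open import Data.List.Membership.Propositional.Properties using (∈-filter⁺; ∈-filter⁻; ∈-allFin)
open import Data.List.Properties using
  (map-++; ++-assoc; ++-identityʳ; ++-ʳ++; length-++; length-tabulate; length-replicate)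
open import Data.List.Relation.Unary.Any as Any using (Any; here; there)
open import Data.Maybe.Base using (just)
open import Data.Nat.Base using (ℕ; zero; suc; _+_; _*_; _≤_; z≤n; s≤s; s<s⁻¹)
import Data.Nat.Properties as ℕ
open import Data.Nat.Properties using (+-assoc; +-identityʳ; +-suc; suc-injective)
open import Data.Nat.Tactic.RingSolver using (solve-∀)
open import Data.Product.Base as Product using (_×_; _,_; ∃-syntax; proj₁; proj₂; uncurry)
open import Data.Sum.Base as Sum using (_⊎_; inj₁; inj₂; swap)
open import Data.Unit.Base using (⊤; tt)
open import Data.Vec.Base as Vec using (Vec; []; _∷_)
open import Data.Vec.Properties using (lookup∘tabulate; lookup⇒[]=; []=⇒lookup)
open import Function.Base using (_∘_; case_of_)
open import Function.Bundles using (_⇔_; mk⇔; Equivalence)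
open import Relation.Binary.Definitions using (tri<; tri≈; tri>)
open import Relation.Binary.PropositionalEquality using
  (_≡_; _≢_; refl; sym; trans; cong; cong₂; subst)
open import Relation.Nullary using
  (¬_; Dec; yes; no; does; _because_; Reflects; ofʸ; ofⁿ; contradiction)
open import Relation.Nullary.Decidable as Dec using
  (_×-dec_; _⊎-dec_; ¬?; dec-true; dec-false; decidable-stable)

-- Induced cycles and independent sets

-- Giving the pairs i < j as nested tuples lets concrete cycles be written down
-- without the absurd cases of a match on i < j.
Row : ∀ k → (Fin k → Set) → Set
Row zero    P = ⊤
Row (suc k) P = P zero × Row k (P ∘ suc)

Triangle : ∀ k → (Fin k → Fin k → Set) → Set
Triangle zero    R = ⊤
Triangle (suc k) R = Row k (R zero ∘ suc) × Triangle k (λ i j → R (suc i) (suc j))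

row : ∀ {k P} → Row k P → ∀ i → P i
row (p , _)  zero    = p
row (_ , ps) (suc i) = row ps i

triangle : ∀ {k R} → Triangle k R → ∀ i j → i < j → R i j
triangle (r , _)  zero    (suc j) _   = row r j
triangle (_ , rs) (suc i) (suc j) i<j = triangle rs i j (s<s⁻¹ i<j)

if-dec : ∀ {A P Q : Set} (a? : Dec A) → (if does a? then P else Q) → (A × P) ⊎ (¬ A × Q)
if-dec (yes a) p = inj₁ (a , p)
if-dec (no ¬a) q = inj₂ (¬a , q)

module _ {n : ℕ} where
  open DecMembership (_≟_ {n}) public using () renaming (_∈?_ to _∈ₗ?_)

module _ {n : ℕ} (G : Graph n) where
  open Graph G

  Apart : Fin n → Fin n → Set
  Apart u v = u ≢ v × ¬ u ~ v

  cyclicallyAdjacent? : ∀ {k} (i j : Fin k) → Dec (CyclicallyAdjacent G i j)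
  cyclicallyAdjacent? i j = next? i j ⊎-dec next? j i
    where
    next? : ∀ {k} (i j : Fin k) → Dec (suc (toℕ i) ≡ toℕ j ⊎ (suc (toℕ i) ≡ k × toℕ j ≡ 0))
    next? {k} i j = (suc (toℕ i) ℕ.≟ toℕ j) ⊎-dec ((suc (toℕ i) ℕ.≟ k) ×-dec (toℕ j ℕ.≟ 0))

  -- Branching on `does` makes each pair of concrete indices reduce to adjacency or to `Apart`, so
  -- an explicit cycle needs one proof per pair.
  CyclePair : ∀ {k} → (Fin k → Fin n) → Fin k → Fin k → Set
  CyclePair v i j = if does (cyclicallyAdjacent? i j) then v i ~ v j else Apart (v i) (v j)

  inducedCycle : ∀ {k} → 3 ≤ k → (v : Fin k → Fin n) → Triangle k (CyclePair v) → InducedCycle G k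
  inducedCycle {k} 3≤k v t =
    record { 3≤k = 3≤k ; vertex = v ; injective = injective ; induced = induced }
    where
    ordered : ∀ i j → i < j → v i ≢ v j × (v i ~ v j ⇔ CyclicallyAdjacent G i j)
    ordered i j i<j with if-dec (cyclicallyAdjacent? i j) (triangle t i j i<j)
    ... | inj₁ (c , i~j)      = (λ eq → ~-irrefl eq i~j) , mk⇔ (λ _ → c) (λ _ → i~j)
    ... | inj₂ (¬c , ≢ , i≁j) = ≢ , mk⇔ (λ i~j → contradiction i~j i≁j) (λ c → contradiction c ¬c)

    successor≢ : ∀ (i : Fin k) → ¬ (suc (toℕ i) ≡ toℕ i ⊎ (suc (toℕ i) ≡ k × toℕ i ≡ 0))
    successor≢ i (inj₁ eq)          = ℕ.1+n≢n eq
    -- A wrap-around step from `i` to itself would force `k` to be 1.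
    successor≢ i (inj₂ (eq , i≡0)) =
      contradiction (subst (3 ≤_) (trans (sym eq) (cong suc i≡0)) 3≤k) λ { (s≤s ()) }

    loopless : ∀ (i : Fin k) → ¬ CyclicallyAdjacent G i i
    loopless i (inj₁ next) = successor≢ i next
    loopless i (inj₂ next) = successor≢ i next

    injective : ∀ {i j} → v i ≡ v j → i ≡ j
    injective {i} {j} eq with <-cmp i j
    ... | tri< i<j _ _ = contradiction eq (proj₁ (ordered i j i<j))
    ... | tri≈ _ i≡j _ = i≡j
    ... | tri> _ _ j<i = contradiction (sym eq) (proj₁ (ordered j i j<i))

    open Equivalence

    induced : ∀ i j → v i ~ v j ⇔ CyclicallyAdjacent G i j
    induced i j with <-cmp i j
    ... | tri< i<j _ _    = proj₂ (ordered i j i<j)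
    ... | tri≈ _ refl _   = mk⇔ (λ i~i → contradiction i~i (~-irrefl refl))
                                (λ c → contradiction c (loopless i))
    ... | tri> _ _ j<i    = mk⇔ (λ i~j → swap (to j⇔i (~-sym i~j))) (λ c → ~-sym (from j⇔i (swap c)))
      where j⇔i = proj₂ (ordered j i j<i)

  Hit : Subset n → Fin n → Set
  Hit S v = ∃[ u ] u ∈ S × u ~ v

  hit? : ∀ S v → Dec (Hit S v)
  hit? S v = any? (λ u → (u ∈? S) ×-dec (u ~? v))

  module _ (X Y : Subset n) where

    Free : Fin n → Set
    Free v = v ∉ X × v ∉ Y × ¬ Hit X v × ¬ Hit Y v

    Contested : Fin n → Set
    Contested v = v ∉ X × v ∉ Y × (Hit X v × ¬ Hit Y v ⊎ ¬ Hit X v × Hit Y v)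

    Dominated : Fin n → Set
    Dominated v = ∃[ w ] Free w × w ~ v

    free? : ∀ v → Dec (Free v)
    free? v = ¬? (v ∈? X) ×-dec ¬? (v ∈? Y) ×-dec ¬? (hit? X v) ×-dec ¬? (hit? Y v)

    contested? : ∀ v → Dec (Contested v)
    contested? v = ¬? (v ∈? X) ×-dec ¬? (v ∈? Y) ×-dec
      ((hit? X v ×-dec ¬? (hit? Y v)) ⊎-dec (¬? (hit? X v) ×-dec hit? Y v))

    dominated? : ∀ v → Dec (Dominated v)
    dominated? v = any? (λ w → free? w ×-dec (w ~? v))

    -- Recording which side is hit lets the path lemmas be proved for two abstract sides and reused
    -- with `X` and `Y` interchanged.
    Sided : Fin n → Set
    Sided v = v ∉ X × v ∉ Y × Hit X v × ¬ Hit Y v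

  free-swap : ∀ {X Y v} → Free X Y v → Free Y X v
  free-swap (v∉X , v∉Y , ¬Xv , ¬Yv) = v∉Y , v∉X , ¬Yv , ¬Xv

  apart-from : ∀ {v S u} → v ∉ S → ¬ Hit S v → u ∈ S → Apart v u
  apart-from v∉S ¬hit u∈S = (λ { refl → v∉S u∈S }) , (λ v~u → ¬hit (_ , u∈S , ~-sym v~u))

  -- Chordality and the exchange argument

  module _ (chordal : Chordal G) where

    no-long-cycle : ∀ {k} (v : Vec (Fin n) (4 + k)) → Triangle _ (CyclePair (Vec.lookup v)) → ⊥
    no-long-cycle v t with chordal (inducedCycle (s≤s (s≤s (s≤s z≤n))) (Vec.lookup v) t)
    ... | ()

    module _ {P Q} (P-independent : Independent G P) (Q-nonempty : Nonempty Q)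
             (complete : ∀ {u v} → u ∈ P → v ∈ Q → u ~ v) where

      -- If `x` or `x′` is adjacent to both ends, the path closes to a 5-cycle. Otherwise it closes
      -- through `x′`, some `y` in `Q` and `x` to a 7-cycle, chordless because `w` and `s` miss both
      -- sides, `t` and `t′` miss `Q`, and `P` is independent.
      no-path-same-side : ∀ {t w s t′} → Sided P Q t → Sided P Q t′ → Free P Q w → Free P Q s →
        t ~ w → w ~ s → s ~ t′ → Apart t s → Apart w t′ → Apart t t′ → ⊥
      no-path-same-side {t} {w} {s} {t′}
        (t∉P , t∉Q , (x , x∈P , x~t) , ¬Qt) (t′∉P , t′∉Q , (x′ , x′∈P , x′~t′) , ¬Qt′)
        (w∉P , w∉Q , ¬Pw , ¬Qw) (s∉P , s∉Q , ¬Ps , ¬Qs) t~w w~s s~t′ ts wt′ tt′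
        with x ~? t′ | x′ ~? t
      ... | yes x~t′ | _ = no-long-cycle (t ∷ w ∷ s ∷ t′ ∷ x ∷ [])
        ( (t~w , ts , tt′ , ~-sym x~t , tt)
        , (w~s , wt′ , apart-from w∉P ¬Pw x∈P , tt)
        , (s~t′ , apart-from s∉P ¬Ps x∈P , tt)
        , (~-sym x~t′ , tt) , tt , tt)
      ... | no _ | yes x′~t = no-long-cycle (t ∷ w ∷ s ∷ t′ ∷ x′ ∷ [])
        ( (t~w , ts , tt′ , ~-sym x′~t , tt)
        , (w~s , wt′ , apart-from w∉P ¬Pw x′∈P , tt)
        , (s~t′ , apart-from s∉P ¬Ps x′∈P , tt)
        , (~-sym x′~t′ , tt) , tt , tt)
      ... | no x≁t′ | no x′≁t = no-long-cycle (t ∷ w ∷ s ∷ t′ ∷ x′ ∷ y ∷ x ∷ [])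
        ( (t~w , ts , tt′ , ((λ { refl → t∉P x′∈P }) , x′≁t ∘ ~-sym)
          , apart-from t∉Q ¬Qt y∈Q , ~-sym x~t , tt)
        , (w~s , wt′ , apart-from w∉P ¬Pw x′∈P , apart-from w∉Q ¬Qw y∈Q
          , apart-from w∉P ¬Pw x∈P , tt)
        , (s~t′ , apart-from s∉P ¬Ps x′∈P , apart-from s∉Q ¬Qs y∈Q , apart-from s∉P ¬Ps x∈P , tt)
        , (~-sym x′~t′ , apart-from t′∉Q ¬Qt′ y∈Q , ((λ { refl → t′∉P x∈P }) , x≁t′ ∘ ~-sym) , tt)
        , (complete x′∈P y∈Q , ((λ { refl → x′≁t x~t }) , P-independent x′∈P x∈P) , tt)
        , (~-sym (complete x∈P y∈Q) , tt) , tt , tt)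
        where
        y = proj₁ Q-nonempty
        y∈Q = proj₂ Q-nonempty

      -- The neighbours `x` of `t` and `y` of `t′` lie on opposite sides, hence are adjacent and
      -- close the path to a 6-cycle.
      no-path-across : ∀ {t w s t′} → Sided P Q t → Sided Q P t′ → Free P Q w → Free P Q s →
        t ~ w → w ~ s → s ~ t′ → Apart t s → Apart w t′ → Apart t t′ → ⊥
      no-path-across {t} {w} {s} {t′}
        (t∉P , t∉Q , (x , x∈P , x~t) , ¬Qt) (t′∉Q , t′∉P , (y , y∈Q , y~t′) , ¬Pt′)
        (w∉P , w∉Q , ¬Pw , ¬Qw) (s∉P , s∉Q , ¬Ps , ¬Qs) t~w w~s s~t′ ts wt′ tt′ =
        no-long-cycle (t ∷ w ∷ s ∷ t′ ∷ y ∷ x ∷ [])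
        ( (t~w , ts , tt′ , apart-from t∉Q ¬Qt y∈Q , ~-sym x~t , tt)
        , (w~s , wt′ , apart-from w∉Q ¬Qw y∈Q , apart-from w∉P ¬Pw x∈P , tt)
        , (s~t′ , apart-from s∉Q ¬Qs y∈Q , apart-from s∉P ¬Ps x∈P , tt)
        , (~-sym y~t′ , apart-from t′∉P ¬Pt′ x∈P , tt)
        , (~-sym (complete x∈P y∈Q) , tt) , tt , tt)

    module _ (B : InducedCompleteBipartite G) where
      open InducedCompleteBipartite B

      private
        sides : ∀ {v} → Contested X Y v → Sided X Y v ⊎ Sided Y X v
        sides (v∉X , v∉Y , inj₁ (Xv , ¬Yv)) = inj₁ (v∉X , v∉Y , Xv , ¬Yv)
        sides (v∉X , v∉Y , inj₂ (¬Xv , Yv)) = inj₂ (v∉Y , v∉X , Yv , ¬Xv)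

        complete˘ : ∀ {u v} → u ∈ Y → v ∈ X → u ~ v
        complete˘ u∈Y v∈X = ~-sym (complete v∈X u∈Y)

      no-path : ∀ {t w s t′} → Contested X Y t → Contested X Y t′ → Free X Y w → Free X Y s →
        t ~ w → w ~ s → s ~ t′ → Apart t s → Apart w t′ → Apart t t′ → ⊥
      no-path ct ct′ fw fs with sides ct | sides ct′
      ... | inj₁ st | inj₁ st′ = no-path-same-side X-independent Y-nonempty complete st st′ fw fs
      ... | inj₁ st | inj₂ st′ = no-path-across X-independent Y-nonempty complete st st′ fw fs
      ... | inj₂ st | inj₁ st′ = no-path-across Y-independent X-nonempty complete˘ st st′
                              (free-swap fw) (free-swap fs)
      ... | inj₂ st | inj₂ st′ = no-path-same-side Y-independent X-nonempty complete˘ st st′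
                              (free-swap fw) (free-swap fs)

      contested≢free : ∀ {t w} → Contested X Y t → Free X Y w → t ≢ w
      contested≢free (_ , _ , inj₁ (Xt , _)) (_ , _ , ¬Xw , _) refl = ¬Xw Xt
      contested≢free (_ , _ , inj₂ (_ , Yt)) (_ , _ , _ , ¬Yw) refl = ¬Yw Yt

      -- This protects the vertices served earlier: if choosing `w` for `t` removes the neighbour
      -- `s` of `t′`, then `w` takes its place.
      exchange : ∀ {t w s t′} → Contested X Y t → Contested X Y t′ → Free X Y w → Free X Y s →
        t ~ w → w ~ s → s ~ t′ → ¬ t ~ s → w ~ t′
      exchange {t} {w} {s} {t′} ct ct′ fw fs t~w w~s s~t′ t≁s =
        decidable-stable (w ~? t′) λ w≁t′ → impossible (contested≢free ct′ fw ∘ sym , w≁t′)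
        where
        ts : Apart t s
        ts = contested≢free ct fs , t≁s

        impossible : Apart w t′ → ⊥
        impossible wt′ with t ~? t′
        ... | yes t~t′ = no-long-cycle (t ∷ w ∷ s ∷ t′ ∷ [])
          ((t~w , ts , t~t′ , tt) , (w~s , wt′ , tt) , (s~t′ , tt) , tt , tt)
        -- The ends differ because `s` is adjacent to `t′` but not to `t`.
        ... | no t≁t′ = no-path ct ct′ fw fs t~w w~s s~t′ ts wt′ ((λ { refl → t≁s (~-sym s~t′) }) , t≁t′)

      -- Lists suit the recursion, which adds and filters out vertices; `fromList` turns the result
      -- into a `Subset`.
      record FreeIndependent (S : List (Fin n)) : Set where
        field
          free        : ∀ {s} → s ∈ₗ S → Free X Y s
          independent : ∀ {u v} → u ∈ₗ S → v ∈ₗ S → ¬ u ~ v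
      open FreeIndependent

      Hits : List (Fin n) → Fin n → Set
      Hits S v = Any (_~ v) S

      insert : ∀ {S w} → FreeIndependent S → Free X Y w → (∀ {s} → s ∈ₗ S → ¬ w ~ s) →
               FreeIndependent (w ∷ S)
      free (insert I fw w≁) (here refl) = fw
      free (insert I fw w≁) (there s∈)  = free I s∈
      independent (insert I fw w≁) (here refl) (here refl) = ~-irrefl refl
      independent (insert I fw w≁) (here refl) (there v∈)  = w≁ v∈
      independent (insert I fw w≁) (there u∈)  (here refl) = w≁ u∈ ∘ ~-sym
      independent (insert I fw w≁) (there u∈)  (there v∈)  = independent I u∈ v∈

      dominating : (∀ t → Contested X Y t → Dominated X Y t) → (D : List (Fin n)) →
        ∃[ S ] FreeIndependent S × (∀ {t} → t ∈ₗ D → Contested X Y t → Hits S t)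
      dominating dom []      = [] , record { free = λ () ; independent = λ () } , λ ()
      dominating dom (t ∷ D) with dominating dom D
      ... | S , I , hits with contested? X Y t | Any.any? (_~? t) S
      ...   | no ¬ct | _      = S , I ,
        λ { (here refl) ct → contradiction ct ¬ct ; (there t∈) ct → hits t∈ ct }
      ...   | yes _  | yes St = S , I ,
        λ { (here refl) ct → St ; (there t∈) ct → hits t∈ ct }
      ...   | yes ct | no ¬St with dom t ct
      ...     | w , fw , w~t = w ∷ S′ , insert I′ fw (λ s∈ → proj₂ (∈-filter⁻ away? {xs = S} s∈)) , hits′
        where
        away? : ∀ s → Dec (¬ w ~ s)
        away? s = ¬? (w ~? s)

        S′ : List (Fin n)
        S′ = filter away? S

        S′⊆S : ∀ {s} → s ∈ₗ S′ → s ∈ₗ S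
        S′⊆S s∈ = proj₁ (∈-filter⁻ away? s∈)

        I′ : FreeIndependent S′
        I′ = record { free = free I ∘ S′⊆S ; independent = λ u∈ v∈ → independent I (S′⊆S u∈) (S′⊆S v∈) }

        hits′ : ∀ {t′} → t′ ∈ₗ t ∷ D → Contested X Y t′ → Hits (w ∷ S′) t′
        hits′ (here refl) _   = here w~t
        hits′ (there t′∈) ct′ with find (hits t′∈ ct′)
        ... | s , s∈S , s~t′ with w ~? s
        -- Here `s` has been filtered out. The last premise of `exchange` holds since `t` had no
        -- neighbour in `S`.
        ...   | yes w~s = here (exchange ct ct′ fw (free I s∈S) (~-sym w~t) w~s s~t′
                                  (λ t~s → ¬St (lose s∈S (~-sym t~s))))
        ...   | no w≁s  = there (lose (∈-filter⁺ away? s∈S w≁s) s~t′)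

      -- Nothing is removed, so earlier hits survive. A vertex already in the list may be added
      -- again, which is harmless.
      extending : ∀ S → FreeIndependent S → (D : List (Fin n)) →
        ∃[ S′ ] FreeIndependent S′ × (∀ {s} → s ∈ₗ S → s ∈ₗ S′) ×
                (∀ {w} → w ∈ₗ D → Free X Y w → w ∈ₗ S′ ⊎ Hits S′ w)
      extending S I []      = S , I , (λ s∈ → s∈) , λ ()
      extending S I (w ∷ D) with extending S I D
      ... | S′ , I′ , S⊆S′ , covers with free? X Y w | Any.any? (_~? w) S′
      ...   | no ¬fw | _       = S′ , I′ , S⊆S′ ,
        λ { (here refl) fw → contradiction fw ¬fw ; (there w∈) fw → covers w∈ fw }
      ...   | yes _  | yes S′w = S′ , I′ , S⊆S′ ,
        λ { (here refl) fw → inj₂ S′w ; (there w∈) fw → covers w∈ fw }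
      ...   | yes fw | no ¬S′w =
        w ∷ S′ , insert I′ fw (λ s∈ w~s → ¬S′w (lose s∈ (~-sym w~s))) , there ∘ S⊆S′ ,
        λ { (here refl) _ → inj₁ (here refl) ; (there w′∈) fw′ → Sum.map there there (covers w′∈ fw′) }

  -- Maximal independent sets and the local criterion

  fromList : List (Fin n) → Subset n
  fromList S = Vec.tabulate λ v → does (v ∈ₗ? S)

  ∈-fromList⁺ : ∀ {S v} → v ∈ₗ S → v ∈ fromList S
  ∈-fromList⁺ {S} {v} v∈ = lookup⇒[]= v _ (trans (lookup∘tabulate _ v) (dec-true (v ∈ₗ? S) v∈))

  ∈-fromList⁻ : ∀ {S v} → v ∈ fromList S → v ∈ₗ S
  ∈-fromList⁻ {S} {v} v∈
    with v ∈ₗ? S | trans (sym (lookup∘tabulate (λ v → does (v ∈ₗ? S)) v)) ([]=⇒lookup v∈)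
  ... | yes v∈S | _ = v∈S

  ∪-maximalIndependent : ∀ {S P} → Independent G S → Independent G P →
    (∀ {s} → s ∈ S → ¬ Hit P s) →
    (∀ v → v ∉ P → ¬ Hit P v → v ∈ S ⊎ Hit S v) → MaximalIndependent G (S ∪ P)
  ∪-maximalIndependent {S} {P} S-ind P-ind ¬hit covers = ind , max
    where
    ind : Independent G (S ∪ P)
    ind {u} {v} u∈ v∈ u~v with x∈p∪q⁻ S P u∈ | x∈p∪q⁻ S P v∈
    ... | inj₁ u∈S | inj₁ v∈S = S-ind u∈S v∈S u~v
    ... | inj₁ u∈S | inj₂ v∈P = ¬hit u∈S (v , v∈P , ~-sym u~v)
    ... | inj₂ u∈P | inj₁ v∈S = ¬hit v∈S (u , u∈P , u~v)
    ... | inj₂ u∈P | inj₂ v∈P = P-ind u∈P v∈P u~v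

    max : ∀ T → Independent G T → ¬ (S ∪ P) ⊂ T
    max T T-ind (⊆T , v , v∈T , v∉) with hit? P v
    ... | yes (p , p∈P , p~v) = T-ind (⊆T (x∈p∪q⁺ (inj₂ p∈P))) v∈T p~v
    ... | no ¬Pv with covers v (λ v∈P → v∉ (x∈p∪q⁺ (inj₂ v∈P))) ¬Pv
    ...   | inj₁ v∈S             = v∉ (x∈p∪q⁺ (inj₁ v∈S))
    ...   | inj₂ (s , s∈S , s~v) = T-ind (⊆T (x∈p∪q⁺ (inj₁ s∈S))) v∈T s~v

  -- Otherwise adding `v` to `T` would give a larger independent set.
  maximal⇒hit : ∀ {T v} → MaximalIndependent G T → v ∉ T → ¬ ¬ Hit T v
  maximal⇒hit {T} {v} (T-ind , max) v∉T ¬Tv = max (T ∪ ⁅ v ⁆) ind ⊂T+v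
    where
    ind : Independent G (T ∪ ⁅ v ⁆)
    ind a∈ b∈ a~b with x∈p∪q⁻ T ⁅ v ⁆ a∈ | x∈p∪q⁻ T ⁅ v ⁆ b∈
    ... | inj₁ a∈T | inj₁ b∈T = T-ind a∈T b∈T a~b
    ... | inj₁ a∈T | inj₂ b∈v = ¬Tv (_ , a∈T , subst (_ ~_) (x∈⁅y⁆⇒x≡y v b∈v) a~b)
    ... | inj₂ a∈v | inj₁ b∈T = ¬Tv (_ , b∈T , ~-sym (subst (_~ _) (x∈⁅y⁆⇒x≡y v a∈v) a~b))
    ... | inj₂ a∈v | inj₂ b∈v = ⁅⁆-independent G v a∈v b∈v a~b

    ⊂T+v : T ⊂ (T ∪ ⁅ v ⁆)
    ⊂T+v = p⊆p∪q ⁅ v ⁆ , v , q⊆p∪q T ⁅ v ⁆ (x∈⁅x⁆ v) , v∉T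

  module _ (B : InducedCompleteBipartite G) where
    open InducedCompleteBipartite B

    locallyDominated⇒generating : Chordal G → (∀ t → Contested X Y t → Dominated X Y t) → Generating G B
    locallyDominated⇒generating chordal dom
      -- Contested vertices are served first, because this may remove vertices; the extension
      -- afterwards only adds some.
      with dominating chordal B dom (allFin n)
    ... | S₀ , I₀ , hits with extending chordal B S₀ I₀ (allFin n)
    ...   | S , I , S₀⊆S , covers =
      fromList S , S-independent ,
      ∪-maximalIndependent S-independent X-independent
        (λ s∈ → proj₁ (proj₂ (proj₂ (S-free s∈)))) covered-by-X ,
      ∪-maximalIndependent S-independent Y-independent
        (λ s∈ → proj₂ (proj₂ (proj₂ (S-free s∈)))) covered-by-Y
      where
      S-free : ∀ {s} → s ∈ fromList S → Free X Y s
      S-free s∈ = FreeIndependent.free I (∈-fromList⁻ s∈)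

      S-independent : Independent G (fromList S)
      S-independent u∈ v∈ = FreeIndependent.independent I (∈-fromList⁻ u∈) (∈-fromList⁻ v∈)

      Hits⇒Hit : ∀ {S v} → Hits chordal B S v → Hit (fromList S) v
      Hits⇒Hit Sv with find Sv
      ... | s , s∈ , s~v = s , ∈-fromList⁺ s∈ , s~v

      contested-hit : ∀ {v} → Contested X Y v → Hit (fromList S) v
      contested-hit {v} cv with Hits⇒Hit (hits (∈-allFin v) cv)
      ... | s , s∈ , s~v = s , ∈-fromList⁺ (S₀⊆S (∈-fromList⁻ s∈)) , s~v

      free-covered : ∀ {v} → Free X Y v → v ∈ fromList S ⊎ Hit (fromList S) v
      free-covered {v} fv = Sum.map ∈-fromList⁺ Hits⇒Hit (covers (∈-allFin v) fv)

      -- As `X` is nonempty and complete to `Y`, a vertex missed by `X` lies outside `Y`; it is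
      -- contested if `Y` hits it and free otherwise.
      covered-by-X : ∀ v → v ∉ X → ¬ Hit X v → v ∈ fromList S ⊎ Hit (fromList S) v
      covered-by-X v v∉X ¬Xv with v ∈? Y | hit? Y v
      ... | yes v∈Y | _      = contradiction (_ , proj₂ X-nonempty , complete (proj₂ X-nonempty) v∈Y) ¬Xv
      ... | no v∉Y | yes Yv = inj₂ (contested-hit (v∉X , v∉Y , inj₂ (¬Xv , Yv)))
      ... | no v∉Y | no ¬Yv = free-covered (v∉X , v∉Y , ¬Xv , ¬Yv)

      covered-by-Y : ∀ v → v ∉ Y → ¬ Hit Y v → v ∈ fromList S ⊎ Hit (fromList S) v
      covered-by-Y v v∉Y ¬Yv with v ∈? X | hit? X v
      ... | yes v∈X | _      =
        contradiction (_ , proj₂ Y-nonempty , ~-sym (complete v∈X (proj₂ Y-nonempty))) ¬Yv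
      ... | no v∉X | yes Xv = inj₂ (contested-hit (v∉X , v∉Y , inj₁ (Xv , ¬Yv)))
      ... | no v∉X | no ¬Xv = free-covered (v∉X , v∉Y , ¬Xv , ¬Yv)

    generating⇒locallyDominated : Generating G B → ∀ t → Contested X Y t → Dominated X Y t
    generating⇒locallyDominated (S , _ , S∪X , S∪Y) t ct =
      decidable-stable (dominated? X Y t) (undominated ct)
      where
      avoids : ∀ {P Q s} → (∀ {u v} → u ∈ P → v ∈ Q → u ~ v) → Nonempty P →
               Independent G (S ∪ P) → s ∈ S → s ∉ Q
      avoids complete (p , p∈P) S∪P s∈S s∈Q =
        S∪P (x∈p∪q⁺ (inj₂ p∈P)) (x∈p∪q⁺ (inj₁ s∈S)) (complete p∈P s∈Q)

      unhit : ∀ {P s} → Independent G (S ∪ P) → s ∈ S → ¬ Hit P s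
      unhit S∪P s∈S (p , p∈P , p~s) = S∪P (x∈p∪q⁺ (inj₂ p∈P)) (x∈p∪q⁺ (inj₁ s∈S)) p~s

      S-free : ∀ {s} → s ∈ S → Free X Y s
      S-free s∈S = avoids (λ u∈ v∈ → ~-sym (complete v∈ u∈)) Y-nonempty (proj₁ S∪Y) s∈S
                 , avoids complete X-nonempty (proj₁ S∪X) s∈S
                 , unhit (proj₁ S∪X) s∈S , unhit (proj₁ S∪Y) s∈S

      unhit-by : ∀ {P} → MaximalIndependent G (S ∪ P) → t ∉ S → t ∉ P → ¬ Hit P t → ¬ ¬ Dominated X Y t
      unhit-by {P} S∪P t∉S t∉P ¬Pt ¬dom = maximal⇒hit S∪P t∉S∪P ¬hit
        where
        t∉S∪P : t ∉ S ∪ P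
        t∉S∪P t∈ with x∈p∪q⁻ S P t∈
        ... | inj₁ t∈S = t∉S t∈S
        ... | inj₂ t∈P = t∉P t∈P

        ¬hit : ¬ Hit (S ∪ P) t
        ¬hit (u , u∈ , u~t) with x∈p∪q⁻ S P u∈
        ... | inj₁ u∈S = ¬dom (u , S-free u∈S , u~t)
        ... | inj₂ u∈P = ¬Pt (u , u∈P , u~t)

      undominated : Contested X Y t → ¬ ¬ Dominated X Y t
      -- Maximality is applied to the union with the side that misses `t`; the other side, which
      -- hits `t`, keeps `t` out of `S`.
      undominated (t∉X , t∉Y , inj₁ (Xt , ¬Yt)) = unhit-by S∪Y (λ t∈S → unhit (proj₁ S∪X) t∈S Xt) t∉Y ¬Yt
      undominated (t∉X , t∉Y , inj₂ (¬Xt , Yt)) = unhit-by S∪X (λ t∈S → unhit (proj₁ S∪Y) t∈S Yt) t∉X ¬Xt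

-- The machine

-- `outside` is a vertex outside X ∪ Y not known to be hit; `onlyX` and `onlyY`
-- are contested vertices not known to be dominated; `settled` is a vertex that
-- is hit from both sides or dominated.
Class : Set
Class = Fin 6

pattern outside = 0F
pattern inX     = 1F
pattern inY     = 2F
pattern onlyX   = 3F
pattern onlyY   = 4F
pattern settled = 5F

Phase : Set
Phase = Fin 5

pattern loadX    = 0F
pattern loadY    = 1F
pattern hit      = 2F
pattern dominate = 3F
pattern final    = 4F

-- These are the head motions: `begin` and `count` measure the unary prefix, `sweep` runs over the
-- columns, `turn` goes to the next row, `back` returns the column head, `copy` also fills the row
-- tape, and `rewind` returns to the start of the matrix.
Control : Set
Control = Fin 7

pattern begin  = 0F
pattern count  = 1F
pattern sweep  = 2F
pattern turn   = 3F
pattern back   = 4F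
pattern copy   = 5F
pattern rewind = 6F

Cell : Set
Cell = Symbol 6

hitX hitY clear : Class → Class

hitX outside = onlyX
hitX onlyY   = settled
hitX c       = c

hitY outside = onlyY
hitY onlyX   = settled
hitY c       = c

clear onlyX = settled
clear onlyY = settled
clear c     = c

-- The bit is a membership bit while loading and an adjacency bit afterwards. In `dominate` a row
-- marked `outside` is a free vertex, as the rows are copied once all hits are recorded.
update : Phase → Cell → Bool → Class → Class
update _        _              false c = c
update loadX    _              true  c = inX
update loadY    _              true  c = inY
update hit      (mark inX)     true  c = hitX c
update hit      (mark inY)     true  c = hitY c
update dominate (mark outside) true  c = clear c
update _        _              true  c = c

pending : Class → Bool
pending onlyX = true
pending onlyY = true
pending _     = false

Instruction : Set
Instruction = Action 6 3 35

go : Control → Phase → Cell × Move → Cell × Move → Cell × Move → Instruction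
go κ p x y z = continue (combine κ p) (x ∷ y ∷ z ∷ [])

-- The arguments are a cell of the column tape, of the input and of the row tape.
-- Everything before the adjacency matrix is overwritten with blanks, so that
-- `rewind` stops at the beginning of the matrix.
sweepAt : Phase → Cell → Cell → Cell → Instruction
sweepAt final    (mark c) a       d =
  if pending c then halt false else go sweep final (a , stay) (mark c , right) (d , stay)
sweepAt final    c        a       d = halt true
sweepAt loadX    (mark c) (bit b) d =
  go sweep loadX (blank , right) (mark (update loadX d b c) , right) (d , stay)
sweepAt loadY    (mark c) (bit b) d =
  go sweep loadY (blank , right) (mark (update loadY d b c) , right) (d , stay)
sweepAt p        (mark c) (bit b) d =
  go sweep p (bit b , right) (mark (update p d b c) , right) (d , stay)
sweepAt loadX    c        a       d = go back loadY (a , stay) (c , left) (d , stay)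
sweepAt loadY    c        a       d = go copy hit (a , stay) (c , left) (d , left)
sweepAt p        c        a       d = go turn p (a , stay) (c , stay) (d , right)

-- A blank row cell means that no row is left: `hit` is followed by a copy of the classes,
-- `dominate` by the final scan.
turnAt : Phase → Cell → Cell → Cell → Instruction
turnAt p   a c (mark d) = go back p (a , stay) (c , left) (mark d , stay)
turnAt hit a c d        = go copy dominate (a , stay) (c , left) (d , left)
turnAt _   a c d        = go back final (a , stay) (c , left) (d , stay)

instruction : Control → Phase → Cell → Cell → Cell → Instruction
-- The cell skipped on each work tape stays blank and later stops `back` and `copy` at the left end.
instruction begin  p a          c        d = go count p (a , stay) (c , right) (d , right)
instruction count  p (bit true) c        d =
  go count p (blank , right) (mark outside , right) (mark outside , right)
-- The row head waits past its last mark until `copy` fills the row tape from right to left.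
instruction count  p a          c        d = go back loadX (blank , right) (c , left) (d , stay)
instruction sweep  p a          c        d = sweepAt p c a d
instruction turn   p a          c        d = turnAt p a c d
instruction back   p a          (mark c) d = go back p (a , stay) (mark c , left) (d , stay)
instruction back   p a          c        d = go sweep p (a , stay) (c , right) (d , stay)
instruction copy   p a          (mark c) d = go copy p (a , stay) (mark c , left) (mark c , left)
-- The input head is just past the cells read so far; one step left puts it on the last matrix bit
-- or on the blank before the matrix.
instruction copy   p a          c        d = go rewind p (a , left) (c , right) (d , right)
instruction rewind p (bit b)    c        d = go rewind p (bit b , left) (c , stay) (d , stay)
instruction rewind p a          c        d = go sweep p (a , right) (c , stay) (d , stay)

transition : Fin 35 → Vec Cell 3 → Instruction
transition q (a ∷ c ∷ d ∷ []) = uncurry instruction (remQuot {7} 5 q) a c d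

machine : TuringMachine
machine = record
  { g = 6 ; extra = 2 ; states = 35 ; start = combine {7} {5} begin loadX ; δ = transition }

-- Runs and their composition

Tape₆ : Set
Tape₆ = Tape 6

at : Control → Phase → Tape₆ → Tape₆ → Tape₆ → Configuration machine
at κ p s t u = config (combine κ p) (s ∷ t ∷ u ∷ [])

infix 3 _⟶[_]_
-- Quantifying over the remaining budget `t` makes runs compose by adding their times.
record _⟶[_]_ (c : Configuration machine) (k : ℕ) (c′ : Configuration machine) : Set where
  field
    run≡ : ∀ t → run machine (k + t) c ≡ run machine t c′
open _⟶[_]_

infixr 5 _∙_
_∙_ : ∀ {c c′ c″ k k′} → c ⟶[ k ] c′ → c′ ⟶[ k′ ] c″ → c ⟶[ k + k′ ] c″
run≡ (_∙_ {c} {k = k} {k′} α β) t =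
  trans (cong (λ m → run machine m c) (+-assoc k k′ t)) (trans (run≡ α (k′ + t)) (run≡ β t))

stand : ∀ {c} → c ⟶[ 0 ] c
run≡ stand t = refl

-- With `M` arbitrary, `δ` stays abstract and `rewrite` can resolve the case split inside `run`.
run-continue : ∀ (M : TuringMachine) {q ts q′ as} k →
               TuringMachine.δ M q (Vec.map Tape.head ts) ≡ continue q′ as →
               run M (suc k) (config q ts) ≡ run M k (config q′ (Vec.zipWith writeMove ts as))
run-continue M k eq rewrite eq = refl

run-halt : ∀ (M : TuringMachine) {q ts b} k →
           TuringMachine.δ M q (Vec.map Tape.head ts) ≡ halt b →
           run M (suc k) (config q ts) ≡ just b
run-halt M k eq rewrite eq = refl

transition-combine : ∀ κ p a c d {i} → instruction κ p a c d ≡ i →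
                     transition (combine κ p) (a ∷ c ∷ d ∷ []) ≡ i
transition-combine κ p a c d eq =
  trans (cong (λ q → uncurry instruction q a c d) (remQuot-combine κ p)) eq

-- The successor is a separate variable c so that the first equation fixes the
-- instruction before c is compared with its effect.
step : ∀ κ p {s t u q x y z c} →
       instruction κ p (Tape.head s) (Tape.head t) (Tape.head u) ≡ continue q (x ∷ y ∷ z ∷ []) →
       config q (writeMove s x ∷ writeMove t y ∷ writeMove u z ∷ []) ≡ c →
       at κ p s t u ⟶[ 1 ] c
run≡ (step κ p {s} {t} {u} eq refl) k =
  run-continue machine {combine κ p} {s ∷ t ∷ u ∷ []} k (transition-combine κ p _ _ _ eq)

infix 3 _⇓[_]_
-- Here `k` is only an upper bound on the time, so the clock may exceed the actual run.
record _⇓[_]_ (c : Configuration machine) (k : ℕ) (b : Bool) : Set where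
  field
    run≡just : ∀ t → run machine (k + t) c ≡ just b
open _⇓[_]_

infixr 5 _◂_
_◂_ : ∀ {c c′ k k′ b} → c ⟶[ k ] c′ → c′ ⇓[ k′ ] b → c ⇓[ k + k′ ] b
run≡just (_◂_ {c} {k = k} {k′} α β) t =
  trans (cong (λ m → run machine m c) (+-assoc k k′ t)) (trans (run≡ α (k′ + t)) (run≡just β t))

stop : ∀ κ p k {s t u b} →
       instruction κ p (Tape.head s) (Tape.head t) (Tape.head u) ≡ halt b →
       at κ p s t u ⇓[ suc k ] b
run≡just (stop κ p k {s} {t} {u} eq) i =
  run-halt machine {combine κ p} {s ∷ t ∷ u ∷ []} (k + i) (transition-combine κ p _ _ _ eq)

-- The head is on the first cell of the second list, or on a blank beyond its end.
cursor : List Cell → List Cell → Tape₆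
cursor ls rs = tape ls (proj₁ (uncons rs)) (proj₂ (uncons rs))

-- Loops of the machine

marks : ∀ {n} → (Fin n → Class) → List Cell
marks c = tabulate (mark ∘ c)

-- The function `f` is what a sweep leaves on the input tape: blanks while loading, the bit itself
-- in the matrix.
Reads : Phase → (Bool → Cell) → Set
Reads p f = ∀ b c d → sweepAt p (mark c) (bit b) d ≡
  go sweep p (f b , right) (mark (update p d b c) , right) (d , stay)

-- Cells already passed lie on the left list in reverse order, hence `_ʳ++_`. The row head stands
-- still, so one row cell governs the whole sweep.
sweeping : ∀ {p f} → Reads p f → ∀ {m} (r : Fin m → Bool) (c : Fin m → Class) {ls rs ks ws u} →
  at sweep p (cursor ls (map bit (tabulate r) ++ rs)) (cursor ks (marks c ++ ws)) u
  ⟶[ m ]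
  at sweep p (cursor (map f (tabulate r) ʳ++ ls) rs)
             (cursor (marks (λ j → update p (Tape.head u) (r j) (c j)) ʳ++ ks) ws) u
sweeping     reads {zero}  r c = stand
sweeping {p} reads {suc m} r c =
  step sweep p (reads _ _ _) refl ∙ sweeping reads (r ∘ suc) (c ∘ suc)

-- Keeping the move unevaluated gives a single statement for an empty and a nonempty stretch to the
-- left.
stepLeft : List Cell → Cell → List Cell → Tape₆
stepLeft ls h rs = move left (tape ls h rs)

retime : ∀ {c c′ k k′} → k ≡ k′ → c ⟶[ k ] c′ → c ⟶[ k′ ] c′
retime refl α = α

backing : ∀ p (L : List Class) {h rs s u} →
  at back p s (stepLeft (map mark L ++ blank ∷ []) h rs) u
  ⟶[ suc (length L) ]
  at sweep p s (cursor (blank ∷ []) (map mark L ʳ++ (h ∷ rs))) u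
backing p []      = step back p refl refl
backing p (c ∷ L) = step back p refl refl ∙ backing p L

-- `L` accumulates the entries as `_ʳ++_` unfolds; the tapes agree by computation and only the time
-- has to be rearranged.
returning : ∀ p {m} (c : Fin m → Class) (L : List Class) {h rs s u} →
  at back p s (stepLeft (marks c ʳ++ (map mark L ++ blank ∷ [])) h rs) u
  ⟶[ suc (m + length L) ]
  at sweep p s (cursor (blank ∷ []) (map mark L ʳ++ (marks c ++ h ∷ rs))) u
returning p {zero}  c L = backing p L
returning p {suc m} c L =
  retime (cong suc (+-suc m (length L))) (returning p (c ∘ suc) (c zero ∷ L))

-- Equal lengths bring both heads to their left blanks at the same time.
copying : ∀ p (L L′ : List Class) → length L ≡ length L′ → ∀ {h rs h′ rs′ s} →
  at copy p s (stepLeft (map mark L ++ blank ∷ []) h rs)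
              (stepLeft (map mark L′ ++ blank ∷ []) h′ rs′)
  ⟶[ suc (length L) ]
  at rewind p (move left s)
              (cursor (blank ∷ []) (map mark L ʳ++ (h ∷ rs)))
              (cursor (blank ∷ []) (map mark L ʳ++ (h′ ∷ rs′)))
copying p []      []        _  = step copy p refl refl
copying p (c ∷ L) (c′ ∷ L′) eq = step copy p refl refl ∙ copying p L L′ (suc-injective eq)

duplicating : ∀ p {m} (c c′ : Fin m → Class) (L L′ : List Class) → length L ≡ length L′ →
  ∀ {h rs h′ rs′ s} →
  at copy p s (stepLeft (marks c ʳ++ (map mark L ++ blank ∷ [])) h rs)
              (stepLeft (marks c′ ʳ++ (map mark L′ ++ blank ∷ [])) h′ rs′)
  ⟶[ suc (m + length L) ]
  at rewind p (move left s)
              (cursor (blank ∷ []) (map mark L ʳ++ (marks c ++ h ∷ rs)))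
              (cursor (blank ∷ []) (map mark L ʳ++ (marks c ++ h′ ∷ rs′)))
duplicating p {zero}  c c′ L L′ eq = copying p L L′ eq
duplicating p {suc m} c c′ L L′ eq = retime (cong suc (+-suc m (length L)))
  (duplicating p (c ∘ suc) (c′ ∘ suc) (c zero ∷ L) (c′ zero ∷ L′) (cong suc eq))

rewinding : ∀ p (L : List Bool) {h rs ls t u} →
  at rewind p (stepLeft (map bit L ++ blank ∷ ls) h rs) t u
  ⟶[ suc (length L) ]
  at sweep p (cursor (blank ∷ ls) (map bit L ʳ++ (h ∷ rs))) t u
rewinding p []      = step rewind p refl refl
rewinding p (b ∷ L) = step rewind p refl refl ∙ rewinding p L

restarting : ∀ p (w L : List Bool) {h rs ls t u} →
  at rewind p (stepLeft (map bit w ʳ++ (map bit L ++ blank ∷ ls)) h rs) t u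
  ⟶[ suc (length w + length L) ]
  at sweep p (cursor (blank ∷ ls) (map bit L ʳ++ (map bit w ++ h ∷ rs))) t u
restarting p []      L = rewinding p L
restarting p (b ∷ w) L =
  retime (cong suc (+-suc (length w) (length L))) (restarting p w (b ∷ L))

counting : ∀ p m {ls rs ks ks′} →
  at count p (cursor ls (map bit (replicate m true) ++ rs)) (cursor ks []) (cursor ks′ [])
  ⟶[ m ]
  at count p (cursor (replicate m blank ʳ++ ls) rs)
             (cursor (marks {m} (λ _ → outside) ʳ++ ks) [])
             (cursor (marks {m} (λ _ → outside) ʳ++ ks′) [])
counting p zero    = stand
counting p (suc m) = step count p refl refl ∙ counting p m

record RowPhase (p : Phase) : Set where
  field
    reads : Reads p bit
    ends  : ∀ a d → sweepAt p blank a d ≡ go turn p (a , stay) (blank , stay) (d , right)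

hitRows : RowPhase hit
hitRows = record { reads = λ _ _ _ → refl ; ends = λ _ _ → refl }

dominateRows : RowPhase dominate
dominateRows = record { reads = λ _ _ _ → refl ; ends = λ _ _ → refl }

flat : ∀ {m n} → (Fin m → Fin n → Bool) → List Bool
flat A = concat (tabulate λ i → tabulate (A i))

-- The row classes `d` stay frozen while the column classes change from row to row.
pass : ∀ (p : Phase) {m n} → (Fin m → Class) → (Fin m → Fin n → Bool) → (Fin n → Class) → Fin n → Class
pass p {zero}  d A c = c
pass p {suc m} d A c =
  pass p (d ∘ suc) (A ∘ suc) (λ j → update p (mark (d zero)) (A zero j) (c j))

-- The running times are left in the shape in which the steps are composed.
passTime : ℕ → ℕ → ℕ
passTime zero    n = n + 1
passTime (suc m) n = n + (1 + (1 + (suc (n + 0) + passTime m n)))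

map-++-++ : ∀ (xs ys : List Bool) (rs : List Cell) →
            map bit (xs ++ ys) ++ rs ≡ map bit xs ++ (map bit ys ++ rs)
map-++-++ xs ys rs = trans (cong (_++ rs) (map-++ bit xs ys)) (++-assoc (map bit xs) _ rs)

map-++-ʳ++ : ∀ (xs ys : List Bool) (ls : List Cell) →
             map bit (xs ++ ys) ʳ++ ls ≡ map bit ys ʳ++ (map bit xs ʳ++ ls)
map-++-ʳ++ xs ys ls = trans (cong (_ʳ++ ls) (map-++ bit xs ys)) (++-ʳ++ (map bit xs))

-- As in `passTime`, `m` counts the rows after the first: the last row ends in `turn` without
-- returning the column head.
passing : ∀ {p} → RowPhase p → ∀ m {n} (d : Fin (suc m) → Class) (A : Fin (suc m) → Fin n → Bool)
  (c : Fin n → Class) {ls rs ks vs} →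
  at sweep p (cursor ls (map bit (flat A) ++ rs))
             (cursor (blank ∷ []) (marks c ++ blank ∷ []))
             (cursor ks (marks d ++ vs))
  ⟶[ passTime m n ]
  at turn p (cursor (map bit (flat A) ʳ++ ls) rs)
            (cursor (marks (pass p d A c) ʳ++ blank ∷ []) [])
            (cursor (marks d ʳ++ ks) vs)
passing {p} π m d A c {ls} {rs}
  rewrite map-++-++ (tabulate (A zero)) (flat (A ∘ suc)) rs
        | map-++-ʳ++ (tabulate (A zero)) (flat (A ∘ suc)) ls
  with m
... | zero  = sweeping (RowPhase.reads π) (A zero) c ∙ step sweep p (RowPhase.ends π _ _) refl
... | suc m = sweeping (RowPhase.reads π) (A zero) c ∙ step sweep p (RowPhase.ends π _ _) refl
            ∙ step turn p refl refl ∙ returning p _ []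
            ∙ passing π m (d ∘ suc) (A ∘ suc) _

-- A run of blanks looks the same from both ends; this exposes a blank just before the matrix.
blanks-ʳ++ : ∀ (w : List Bool) (ls : List Cell) →
             map (λ _ → blank) w ʳ++ (blank ∷ ls) ≡ blank ∷ (map (λ _ → blank) w ʳ++ ls)
blanks-ʳ++ []      ls = refl
blanks-ʳ++ (_ ∷ w) ls = blanks-ʳ++ w (blank ∷ ls)

final-pending : ∀ {c a d} → pending c ≡ true → sweepAt final (mark c) a d ≡ halt false
final-pending eq rewrite eq = refl

final-resolved : ∀ {c a d} → pending c ≡ false →
  sweepAt final (mark c) a d ≡ go sweep final (a , stay) (mark c , right) (d , stay)
final-resolved eq rewrite eq = refl

scanning : ∀ {m} (c : Fin m → Class) {s ks ws u} →
  ∃[ b ] (at sweep final s (cursor ks (marks c ++ blank ∷ ws)) u ⇓[ suc m ] b)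
       × Reflects (∀ j → pending (c j) ≡ false) b
scanning {zero}  c = true , stop sweep final 0 refl , ofʸ (λ ())
scanning {suc m} c {s} {ks} {ws} {u} with pending (c zero) in eq
-- The scan ends early; the remaining `suc m` steps are spare.
... | true  = false , stop sweep final (suc m) (final-pending eq)
            , ofⁿ (λ h → case trans (sym eq) (h zero) of λ ())
... | false with scanning (c ∘ suc) {s} {mark (c zero) ∷ ks} {ws} {u}
...   | b , halts , r =
  b , step sweep final (final-resolved eq) refl ◂ halts
    , Dec.proof (Dec.map′ (λ h → λ { zero → eq ; (suc j) → h j })
                          (λ h j → h (suc j)) (b because r))

-- Running time

passTime-closed : ∀ k n → passTime k n ≡ n + 1 + k * (2 * n + 3)
passTime-closed zero    n = sym (+-identityʳ _)
-- Every row but the last takes `n` steps of sweeping, two to end the sweep and turn, and `suc n` to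
-- go back.
passTime-closed (suc k) n =
  trans (cong (λ t → n + (1 + (1 + (suc (n + 0) + t)))) (passTime-closed k n)) (lemma k n)
  where
  lemma : ∀ k n → n + (1 + (1 + (suc (n + 0) + (n + 1 + k * (2 * n + 3))))) ≡
                  n + 1 + suc k * (2 * n + 3)
  lemma = solve-∀

length-flat : ∀ {k l} (A : Fin k → Fin l → Bool) → length (flat A) ≡ k * l
length-flat {zero}      A = refl
length-flat {suc k} {l} A = trans (length-++ (tabulate (A zero)))
  (cong₂ _+_ (length-tabulate (A zero)) (length-flat (A ∘ suc)))

loadTime : ℕ → ℕ
loadTime n = 1 + (n + (1 + (suc (n + 0) + (n + (1 + (suc (n + 0) + (n + (1 + (suc (n + 0) + 1)))))))))

decideTime : (passing flat n : ℕ) → ℕ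
decideTime t k n = t + (1 + (suc (n + 0) + (suc (k + 0) + (t + (1 + suc (n + 0))))))

runTime : (passing flat n : ℕ) → ℕ
runTime t k n = loadTime n + (decideTime t k n + suc n)

-- For `n ≥ 1` the run is allotted `5n² + 13n + 10` steps and the word has length `n² + 3n + 1`, so
-- seven times the length is enough.
bound : Polynomial
bound = 0 ∷ 7 ∷ []

-- This is the exact surplus at `n = suc m`; naming it turns the inequality into an identity for the
-- ring solver.
slack : ℕ → ℕ
slack m = 2 * (m * m) + 12 * m + 7

runTime-closed : ∀ t k n → runTime t k n ≡ 2 * t + k + (9 * n + 14)
runTime-closed t k n = lemma t k n
  where
  lemma : ∀ t k n →
    1 + (n + (1 + (suc (n + 0) + (n + (1 + (suc (n + 0) + (n + (1 + (suc (n + 0) + 1)))))))))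
      + ((t + (1 + (suc (n + 0) + (suc (k + 0) + (t + (1 + suc (n + 0))))))) + suc n)
    ≡ 2 * t + k + (9 * n + 14)
  lemma = solve-∀

evaluate-bound : ∀ l → evaluate bound l ≡ 7 * l
evaluate-bound l = lemma l
  where
  lemma : ∀ l → 0 + l * (7 + l * 0) ≡ 7 * l
  lemma = solve-∀

runTime-bound : ∀ m →
  runTime (suc m + 1 + m * (2 * suc m + 3)) (suc m * suc m) (suc m) + slack m ≡
  evaluate bound (suc m + suc (suc m + (suc m + suc m * suc m)))
runTime-bound m =
  trans (cong (_+ slack m) (runTime-closed (suc m + 1 + m * (2 * suc m + 3)) _ (suc m)))
        (trans (lemma m) (sym (evaluate-bound (suc m + suc (suc m + (suc m + suc m * suc m))))))
  where
  lemma : ∀ m →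
    2 * (suc m + 1 + m * (2 * suc m + 3)) + suc m * suc m + (9 * suc m + 14) + (2 * (m * m) + 12 * m + 7)
    ≡ 7 * (suc m + suc (suc m + (suc m + suc m * suc m)))
  lemma = solve-∀

Decides : List Bool → Set → Set
Decides w P = ∃[ b ]
  run machine (evaluate bound (length w)) (initial machine w) ≡ just b × Reflects P b

-- The complete run on a word

module _ {m} (X Y : Fin (suc m) → Bool) (A : Fin (suc m) → Fin (suc m) → Bool) where
  private
    n = suc m

  -- The column classes after counting, loading `X`, loading `Y`, `hit` and `dominate`. Each of the
  -- last two stages uses the preceding column as its rows, as `copy` arranges.
  column₀ column₁ column₂ column₃ column₄ : Fin n → Class
  column₀ _ = outside
  column₁ j = update loadX blank (X j) (column₀ j)
  column₂ j = update loadY blank (Y j) (column₁ j)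
  column₃   = pass hit column₂ A column₂
  column₄   = pass dominate column₃ A column₃

  word : List Bool
  word = replicate n true ++ false ∷ tabulate X ++ tabulate Y ++ flat A

  -- Bracketed so that each segment stands where the loops expect it; the final `[]` is the rest of
  -- the tape in `passing`.
  input : List Cell
  input = map bit (replicate n true) ++ bit false ∷
            (map bit (tabulate X) ++ (map bit (tabulate Y) ++ (map bit (flat A) ++ [])))

  map-word : map bit word ≡ input
  map-word =
    trans (map-++ bit (replicate n true) _)
          (cong (λ w → map bit (replicate n true) ++ bit false ∷ w)
    (trans (map-++ bit (tabulate X) _) (cong (map bit (tabulate X) ++_)
    (trans (map-++ bit (tabulate Y) _) (cong (map bit (tabulate Y) ++_) (sym (++-identityʳ _)))))))

  erased : List Cell
  erased = map (λ _ → blank) (tabulate Y) ʳ++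
           (map (λ _ → blank) (tabulate X) ʳ++ (replicate n blank ʳ++ []))

  -- The input head was already on the first matrix cell, so `copy` moves it onto a blank and
  -- `rewind` moves it straight back.
  reopening : ∀ {b rs t u} →
    at rewind hit (move left (cursor (map (λ _ → blank) (tabulate Y) ʳ++
                                       (map (λ _ → blank) (tabulate X) ʳ++
                                         (blank ∷ (replicate n blank ʳ++ [])))) (b ∷ rs))) t u
    ⟶[ 1 ]
    at sweep hit (cursor (blank ∷ erased) (b ∷ rs)) t u
  reopening rewrite blanks-ʳ++ (tabulate X) (replicate n blank ʳ++ [])
                  | blanks-ʳ++ (tabulate Y) (map (λ _ → blank) (tabulate X) ʳ++
                                                (replicate n blank ʳ++ []))
    = step rewind hit refl refl

  loading :
    at begin loadX (cursor [] input) (loaded []) (loaded [])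
    ⟶[ loadTime n ]
    at sweep hit (cursor (blank ∷ erased) (map bit (flat A) ++ []))
                 (cursor (blank ∷ []) (marks column₂ ++ blank ∷ []))
                 (cursor (blank ∷ []) (marks column₂ ++ blank ∷ []))
  loading =
      step begin loadX refl refl ∙ counting loadX n ∙ step count loadX refl refl
    ∙ returning loadX column₀ []
    ∙ sweeping (λ _ _ _ → refl) X column₀
    ∙ step sweep loadX refl refl ∙ returning loadY column₁ []
    ∙ sweeping (λ _ _ _ → refl) Y column₁
    -- The row tape still holds the marks from `counting`, described by `column₀`.
    ∙ step sweep loadY refl refl ∙ duplicating hit column₂ column₀ [] [] refl
    ∙ reopening

  deciding : ∃[ ls ] ∃[ rs ] ∃[ u ]
    at sweep hit (cursor (blank ∷ erased) (map bit (flat A) ++ []))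
                 (cursor (blank ∷ []) (marks column₂ ++ blank ∷ []))
                 (cursor (blank ∷ []) (marks column₂ ++ blank ∷ []))
    ⟶[ decideTime (passTime m n) (length (flat A)) n ]
    at sweep final (cursor ls rs) (cursor (blank ∷ []) (marks column₄ ++ blank ∷ [])) u
  deciding = _ , [] , _ ,
    (passing hitRows m column₂ A column₂ ∙ step turn hit refl refl
    ∙ duplicating dominate column₃ column₂ [] [] refl ∙ restarting dominate (flat A) []
    ∙ passing dominateRows m column₃ A column₃ ∙ step turn dominate refl refl
    ∙ returning final column₄ [])

  answering : ∃[ b ] (initial machine word ⇓[ runTime (passTime m n) (length (flat A)) n ] b)
                   × Reflects (∀ j → pending (column₄ j) ≡ false) b
  answering with deciding
  ... | ls , rs , u , decides with scanning column₄ {cursor ls rs} {blank ∷ []} {[]} {u}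
  ...   | b , halts , r =
    b , subst (λ w → at begin loadX (cursor [] w) (loaded []) (loaded [])
                     ⇓[ runTime (passTime m n) (length (flat A)) n ] b)
              (sym map-word) (loading ◂ decides ◂ halts) , r

  length-word : length word ≡ n + suc (n + (n + n * n))
  length-word = trans (length-++ (replicate n true)) (cong₂ _+_ (length-replicate n) (cong suc
    (trans (length-++ (tabulate X)) (cong₂ _+_ (length-tabulate X)
    (trans (length-++ (tabulate Y)) (cong₂ _+_ (length-tabulate Y) (length-flat A)))))))

  runs : Decides word (∀ j → pending (column₄ j) ≡ false)
  runs = Product.map₂ (Product.map₁ λ halts →
      trans (cong (λ t → run machine t (initial machine word)) (sym time)) (run≡just halts (slack m)))
    answering
    where
    time : runTime (passTime m n) (length (flat A)) n + slack m ≡ evaluate bound (length word)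
    time =
      trans (cong₂ (λ t k → runTime t k n + slack m) (passTime-closed m n) (length-flat A))
            (trans (runTime-bound m) (cong (evaluate bound) (sym length-word)))

-- Correctness of the column classes

-- The invariant: membership in `X` and `Y` together with the hits found so far determine the class.
classify : (x y hx hy : Bool) → Class
classify true  _     _     _     = inX
classify false true  _     _     = inY
classify false false false false = outside
classify false false true  false = onlyX
classify false false false true  = onlyY
classify false false true  true  = settled

loadedClass : Bool → Bool → Class
loadedClass x y = update loadY blank y (update loadX blank x outside)

-- Loading `Y` overwrites `inX`, whereas `classify` prefers `inX`; disjointness rules out the
-- conflict.
loadedClass≡classify : ∀ x y → x ∧ y ≡ false → loadedClass x y ≡ classify x y false false
loadedClass≡classify false false _ = refl
loadedClass≡classify false true  _ = refl
loadedClass≡classify true  false _ = refl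

hitX-classify : ∀ x y a b → hitX (classify x y a b) ≡ classify x y true b
hitX-classify true  _     _     _     = refl
hitX-classify false true  _     _     = refl
hitX-classify false false true  true  = refl
hitX-classify false false true  false = refl
hitX-classify false false false true  = refl
hitX-classify false false false false = refl

hitY-classify : ∀ x y a b → hitY (classify x y a b) ≡ classify x y a true
hitY-classify true  _     _     _     = refl
hitY-classify false true  _     _     = refl
hitY-classify false false true  true  = refl
hitY-classify false false true  false = refl
hitY-classify false false false true  = refl
hitY-classify false false false false = refl

hit-row : ∀ x′ y′ e x y a b → x′ ∧ y′ ≡ false →
  update hit (mark (loadedClass x′ y′)) e (classify x y a b) ≡ classify x y (x′ ∧ e ∨ a) (y′ ∧ e ∨ b)
hit-row false false false x y a b _ = refl
hit-row false false true  x y a b _ = refl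
hit-row false true  false x y a b _ = refl
hit-row false true  true  x y a b _ = hitY-classify x y a b
hit-row true  false false x y a b _ = refl
hit-row true  false true  x y a b _ = hitX-classify x y a b

anyᵇ : ∀ {m} → (Fin m → Bool) → Bool
anyᵇ {zero}  f = false
anyᵇ {suc m} f = f zero ∨ anyᵇ (f ∘ suc)

-- This turns decided quantifiers over vertices into the disjunctions that a pass accumulates.
does-any? : ∀ {m} {P : Fin m → Set} (P? : ∀ i → Dec (P i)) → does (any? P?) ≡ anyᵇ (does ∘ P?)
does-any? {zero}  P? = refl
does-any? {suc m} P? = cong (does (P? zero) ∨_) (does-any? (P? ∘ suc))

pass-hit : ∀ {m n} (X Y : Fin m → Bool) (A : Fin m → Fin n → Bool) → (∀ i → X i ∧ Y i ≡ false) →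
  ∀ (c : Fin n → Class) j {x y a b} → c j ≡ classify x y a b →
  pass hit (λ i → loadedClass (X i) (Y i)) A c j ≡
  classify x y (anyᵇ (λ i → X i ∧ A i j) ∨ a) (anyᵇ (λ i → Y i ∧ A i j) ∨ b)
pass-hit {zero}  X Y A disjoint c j eq = eq
pass-hit {suc m} X Y A disjoint c j {x} {y} {a} {b} eq =
  trans (pass-hit (X ∘ suc) (Y ∘ suc) (A ∘ suc) (disjoint ∘ suc) _ j
          (trans (cong (update hit (mark (loadedClass (X zero) (Y zero))) (A zero j)) eq)
                 (hit-row (X zero) (Y zero) (A zero j) x y a b (disjoint zero))))
        -- The first row was accumulated innermost and has to move to the front of `anyᵇ`.
        (cong₂ (classify x y) (x∙yz≈yx∙z (anyᵇ λ i → X (suc i) ∧ A (suc i) j) (X zero ∧ A zero j) a)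
                              (x∙yz≈yx∙z (anyᵇ λ i → Y (suc i) ∧ A (suc i) j) (Y zero ∧ A zero j) b))

isOutside : Class → Bool
isOutside outside = true
isOutside _       = false

pending-clear : ∀ c → pending (clear c) ≡ false
pending-clear 0F = refl
pending-clear 1F = refl
pending-clear 2F = refl
pending-clear 3F = refl
pending-clear 4F = refl
pending-clear 5F = refl

-- In the second pass only `pending` is tracked, as the final scan reads nothing else.
dominate-row : ∀ d e c → pending (update dominate (mark d) e c) ≡ pending c ∧ not (isOutside d ∧ e)
dominate-row 0F true  c = trans (pending-clear c) (sym (∧-zeroʳ (pending c)))
dominate-row 1F true  c = sym (∧-identityʳ _)
dominate-row 2F true  c = sym (∧-identityʳ _)
dominate-row 3F true  c = sym (∧-identityʳ _)
dominate-row 4F true  c = sym (∧-identityʳ _)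
dominate-row 5F true  c = sym (∧-identityʳ _)
dominate-row d  false c =
  sym (trans (cong (λ b → pending c ∧ not b) (∧-zeroʳ (isOutside d))) (∧-identityʳ _))

-- Each row contributes one negated conjunct; De Morgan's law collects them.
pass-dominate : ∀ {m n} (d : Fin m → Class) (A : Fin m → Fin n → Bool) (c : Fin n → Class) j →
  pending (pass dominate d A c j) ≡ pending (c j) ∧ not (anyᵇ (λ i → isOutside (d i) ∧ A i j))
pass-dominate {zero}  d A c j = sym (∧-identityʳ _)
pass-dominate {suc m} d A c j =
  trans (pass-dominate (d ∘ suc) (A ∘ suc) _ j)
  (trans (cong (_∧ not q) (dominate-row (d zero) (A zero j) (c j)))
  (trans (∧-assoc (pending (c j)) (not p) (not q)) (cong (pending (c j) ∧_) (sym (deMorgan₂ p q)))))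
  where
  p = isOutside (d zero) ∧ A zero j
  q = anyᵇ λ i → isOutside (d (suc i)) ∧ A (suc i) j

-- The right-hand side has the shape to which `does` of `free?` reduces; `pending-classify` does the
-- same for `contested?`.
isOutside-classify : ∀ x y a b → isOutside (classify x y a b) ≡ not x ∧ not y ∧ not a ∧ not b
isOutside-classify true  _     _     _     = refl
isOutside-classify false true  _     _     = refl
isOutside-classify false false true  true  = refl
isOutside-classify false false true  false = refl
isOutside-classify false false false true  = refl
isOutside-classify false false false false = refl

pending-classify : ∀ x y a b → pending (classify x y a b) ≡ not x ∧ not y ∧ (a ∧ not b ∨ not a ∧ b)
pending-classify true  _     _     _     = refl
pending-classify false true  _     _     = refl
pending-classify false false true  true  = refl
pending-classify false false true  false = refl
pending-classify false false false true  = refl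
pending-classify false false false false = refl

anyᵇ-cong : ∀ {m} {f g : Fin m → Bool} → (∀ i → f i ≡ g i) → anyᵇ f ≡ anyᵇ g
anyᵇ-cong {zero}  eq = refl
anyᵇ-cong {suc m} eq = cong₂ _∨_ (eq zero) (anyᵇ-cong (eq ∘ suc))

toList-∈? : ∀ {n} (S : Subset n) → Vec.toList S ≡ tabulate (λ v → does (v ∈? S))
toList-∈? []          = refl
toList-∈? (true ∷ S)  = cong (true ∷_) (toList-∈? S)
toList-∈? (false ∷ S) = cong (false ∷_) (toList-∈? S)

-- The answer of the machine and the local criterion

module _ {m} (G : Graph (suc m)) (B : InducedCompleteBipartite G) where
  open Graph G
  open InducedCompleteBipartite B

  private
    n = suc m

    member : Subset n → Fin n → Bool
    member S v = does (v ∈? S)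

    adjacent : Fin n → Fin n → Bool
    adjacent u v = does (u ~? v)

    disjoint : ∀ v → member X v ∧ member Y v ≡ false
    disjoint v = dec-false ((v ∈? X) ×-dec (v ∈? Y)) λ (v∈X , v∈Y) → ~-irrefl refl (complete v∈X v∈Y)

  column₃-classify : ∀ j → column₃ (member X) (member Y) adjacent j ≡
    classify (member X j) (member Y j) (does (hit? G X j)) (does (hit? G Y j))
  column₃-classify j = trans
    (pass-hit (member X) (member Y) adjacent disjoint _ j (loadedClass≡classify _ _ (disjoint j)))
    (cong₂ (classify (member X j) (member Y j))
      (trans (∨-identityʳ _) (sym (does-any? (λ u → (u ∈? X) ×-dec (u ~? j)))))
      (trans (∨-identityʳ _) (sym (does-any? (λ u → (u ∈? Y) ×-dec (u ~? j))))))

  pending-column₄ : ∀ j → pending (column₄ (member X) (member Y) adjacent j) ≡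
    does (contested? G X Y j ×-dec ¬? (dominated? G X Y j))
  pending-column₄ j = trans
    (pass-dominate (column₃ (member X) (member Y) adjacent) adjacent _ j) (cong₂ (λ a b → a ∧ not b)
    (trans (cong pending (column₃-classify j))
           (pending-classify (member X j) (member Y j) (does (hit? G X j)) _))
    (trans (anyᵇ-cong (λ i → cong (_∧ adjacent i j)
              (trans (cong isOutside (column₃-classify i))
                     (isOutside-classify (member X i) (member Y i) (does (hit? G X i)) _))))
           (sym (does-any? (λ w → free? G X Y w ×-dec (w ~? j))))))

  encodeWith-word : encodeWith G X Y ≡ word (member X) (member Y) adjacent
  encodeWith-word = cong₂ (λ xs ys → replicate n true ++ false ∷ xs ++ ys ++ adjacencyMatrix G)
    (toList-∈? X) (toList-∈? Y)

  module _ (chordal : Chordal G) where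

    decide : ∀ {b} →
             Reflects (∀ j → pending (column₄ (member X) (member Y) adjacent j) ≡ false) b →
             Reflects (Generating G B) b
    decide {b} r = Dec.proof (Dec.map′ soundness completeness (b because r))
      where
      soundness : (∀ j → pending (column₄ (member X) (member Y) adjacent j) ≡ false) → Generating G B
      soundness h = locallyDominated⇒generating G B chordal λ t ct →
        decidable-stable (dominated? G X Y t) λ ¬dt →
        contradiction
          (trans (sym (dec-true (contested? G X Y t ×-dec ¬? (dominated? G X Y t)) (ct , ¬dt)))
                 (trans (sym (pending-column₄ t)) (h t))) λ ()

      completeness : Generating G B → ∀ j → pending (column₄ (member X) (member Y) adjacent j) ≡ false
      completeness gen j = trans (pending-column₄ j)
        (dec-false (contested? G X Y j ×-dec ¬? (dominated? G X Y j))
          λ (cj , ¬dj) → ¬dj (generating⇒locallyDominated G B gen j cj))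

    machine-decides : Decides (encodeWith G X Y) (Generating G B)
    machine-decides =
      subst (λ w → Decides w (Generating G B)) (sym encodeWith-word)
        (Product.map₂ (Product.map₂ decide) (runs (member X) (member Y) adjacent))

-- The two decision problems

generatingSubgraph-polynomial : PolynomialTimeDecidable generatingSubgraph
generatingSubgraph-polynomial = machine , bound , decides
  where
  open DecisionProblem generatingSubgraph

  decides : ∀ I → Decides (encode I) (Yes I)
  -- Without vertices no side is nonempty, so the analysis may assume `suc m` vertices.
  decides record { n = zero ; B = record { X-nonempty = () , _ } }
  decides record { n = suc m ; G = G ; chordal = chordal ; B = B } = machine-decides G B chordal

edgeAsBipartite : ChordalGraphWithEdge → ChordalGraphWithBipartite
edgeAsBipartite I = record { G = G ; chordal = chordal ; B = edge G x~y }
  where open ChordalGraphWithEdge I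

-- An edge and its bipartite form have the same word and the same question by definition, so the
-- same machine and bound serve.
relatingEdge-polynomial : PolynomialTimeDecidable relatingEdge
relatingEdge-polynomial =
  Product.map₂ (Product.map₂ λ decides I → decides (edgeAsBipartite I)) generatingSubgraph-polynomial

corollary2p15 : PolynomialTimeDecidable relatingEdge × PolynomialTimeDecidable generatingSubgraph
corollary2p15 = relatingEdge-polynomial , generatingSubgraph-polynomial
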